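{- Let $G$ be a directed acyclic graph, $s$ a vertex of $G$, and $T_s$ a depth-first search arborescence of $G$ rooted at $s$. Let $s_1$ be a child of $s$ in $T_s$, let $u$ and $v$ belong to $T_{s_1}$, let $z = LCA_{T_s}(u,v)$, and suppose $z\neq u$ and $z \neq v$. Then $s \in J(u,v)$ if and only if $s \in J(z,u)$ or $s\in J(z,v)$.
   Context: All paths are directed, and a single vertex counts as a (trivial) directed path. For distinct vertices $u,v$ of $G$, a vertex $s$ is a junction of $u,v$ if there are internally disjoint directed paths $P$ from $s$ to $u$ and $Q$ from $s$ to $v$ in $G$, where internally disjoint means that $s$ is the only vertex common to $P$ and $Q$. $J(u,v)=J(v,u)$ is the set of junctions of $u,v$ in $G$, and $J(u,u)=\emptyset$ by convention. In particular, a proper ancestor $u$ of $v$ lies in $J(u,v)$. The arborescence $T_s$ is the rooted directed tree built by a depth-first search of $G$ started at $s$; its vertices are $s$ and all descendants of $s$ in $G$, and its arcs are the tree arcs of the search. For $u\in T_s$, $T_u$ is the subarborescence of $T_s$ rooted at $u$ (consisting of $u$ and all its descendants in $T_s$). $LCA_{T_s}(u,v)$ is the unique lowest common ancestor of $u$ and $v$ in the rooted tree $T_s$ (it equals $u$ if $u$ is an ancestor of $v$ in $T_s$). -}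

module Defs where

open import Level using (0ℓ)
open import Data.Nat using (ℕ)
open import Data.Fin using (Fin)
open import Data.List using (List; []; _∷_; _++_)
import Data.List.Membership.Propositional as List
open import Data.Product using (Σ-syntax; ∃-syntax; _×_; _,_)
open import Relation.Binary using (Rel)
open import Relation.Binary.PropositionalEquality using (_≡_; _≢_)
open import Relation.Binary.Construct.Closure.ReflexiveTransitive using (Star; ε; _◅_)
open import Relation.Binary.Construct.Closure.Transitive using (TransClosure)
open import Relation.Nullary using (¬_)
open import Relation.Unary using (Pred; _∈_)

record DAG (n : ℕ) : Set₁ where
  field
    Arc     : Rel (Fin n) 0ℓ
    acyclic : ∀ {v} → ¬ TransClosure Arc v v

module _ {n : ℕ} (G : DAG n) where
  open DAG G

  -- By acyclicity a directed walk never repeats a vertex, so directed walks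
  -- and directed paths are the same thing; ε is the trivial path.
  Path : Rel (Fin n) 0ℓ
  Path = Star Arc

  vertices : ∀ {x y} → Path x y → List (Fin n)
  vertices {x} ε       = x ∷ []
  vertices {x} (_ ◅ p) = x ∷ vertices p

  InternallyDisjoint : ∀ {s u v} → Path s u → Path s v → Set
  InternallyDisjoint {s} P Q =
    ∀ {x} → x List.∈ vertices P → x List.∈ vertices Q → x ≡ s

  -- The first component makes J u u empty.
  J : Fin n → Fin n → Pred (Fin n) 0ℓ
  J u v s = u ≢ v ×
    (Σ[ P ∈ Path s u ] Σ[ Q ∈ Path s v ] InternallyDisjoint P Q)

  -- Search v M A M′ : processing the out-arcs of v, starting when the visited
  -- vertices are those in M, can end with those in M′ visited, having
  -- traversed the tree arcs A (within the whole subtree being explored).  The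
  -- order in which out-neighbours are tried is arbitrary, so every depth-first
  -- search is covered; v may be left only once all its out-neighbours are
  -- visited.
  data Search (v : Fin n) (M : List (Fin n)) :
              List (Fin n × Fin n) → List (Fin n) → Set where
    done : (∀ {w} → Arc v w → w List.∈ M) → Search v M [] M
    step : ∀ {w A B M₁ M₂} → Arc v w → w List.∉ M →
           Search w (w ∷ M) A M₁ → Search v M₁ B M₂ →
           Search v M ((v , w) ∷ A ++ B) M₂

  -- An arborescence is given by its root and its list of arcs.
  IsDFSArborescence : Fin n → List (Fin n × Fin n) → Set
  IsDFSArborescence s T = ∃[ M ] Search s (s ∷ []) T M

module _ {n : ℕ} (T : List (Fin n × Fin n)) where

  IsChildOf : Rel (Fin n) 0ℓ
  IsChildOf y x = (x , y) List.∈ T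

  -- Reflexive: every vertex is an ancestor of itself.
  IsAncestorOf : Rel (Fin n) 0ℓ
  IsAncestorOf = Star (λ x y → IsChildOf y x)

  -- The vertex set of the subarborescence rooted at u.
  Subarborescence : Fin n → Pred (Fin n) 0ℓ
  Subarborescence u w = IsAncestorOf u w

  IsLCA : Fin n → Fin n → Fin n → Set
  IsLCA u v z = IsAncestorOf z u × IsAncestorOf z v ×
    (∀ {w} → IsAncestorOf w u → IsAncestorOf w v → IsAncestorOf w z)

{-# OPTIONS --safe #-}
module Submission where

-- Both directions splice paths of G with paths of T.
--
-- From u, v to z.  Let P and Q be disjoint paths from s to u and to v, and let
-- R be the tree path from s to z.  Take the last vertex y of R lying on P or
-- Q.  If y is on P, following P up to y and then R gives a path from s to z
-- that meets Q only in s, so s is a junction of z and v; if y is on Q, then s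
-- is a junction of z and u (reroute).
--
-- From z, u to u, v.  Let P and Q be disjoint paths from s to z and to u.  If
-- Q avoids the tree path from z to v, prolong P by that tree path.  Otherwise
-- Q passes through a vertex x of it; prolong P by the tree path from z to u,
-- and follow Q only up to x, then the tree path from x to v.  Acyclicity and
-- the choice of z as lowest common ancestor exclude all unwanted common
-- vertices of these two paths, except a vertex y where Q, before reaching x,
-- meets the tree path from z to u.  In that case let a be the child of z above
-- y and u.  Now Q leads from y to x and on to u, both ends being in the
-- subarborescence of a.  Such subarborescences are convex in G
-- (subarborescence-convex), so a is an ancestor of x, hence of v, contradicting
-- that z is the lowest common ancestor (junction-below-lca).
--
-- Convexity is the only place where the depth-first order matters.  When a is
-- discovered, every visited vertex either reaches a or has all its
-- out-neighbours visited already (Valid), and when a is left, every vertex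
-- found meanwhile has all its out-neighbours visited.  A path that leaves the
-- vertices found from a therefore enters the vertices visited before a, and
-- it can only come back by passing through a vertex that reaches a, which
-- would close a directed cycle.

open import Defs
open import Data.Nat using (ℕ)
open import Data.Fin using (Fin)
open import Data.Fin.Properties using (_≟_)
open import Data.List using (List; []; _∷_; _++_)
import Data.List.Membership.Propositional as List
open import Data.List.Membership.Propositional.Properties using (∈-++⁺ˡ; ∈-++⁺ʳ; ∈-++⁻)
import Data.List.Membership.DecPropositional as DecMembership
open import Data.List.Relation.Unary.Any using (here; there; any?)
open import Data.Product using (Σ-syntax; ∃-syntax; _×_; _,_; proj₁; proj₂)
open import Data.Sum using (_⊎_; inj₁; inj₂; [_,_]′)
import Data.Sum as Sum
open import Data.Empty using (⊥; ⊥-elim)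
open import Function using (_∘_; id)
open import Function.Bundles using (_⇔_; mk⇔)
open import Relation.Binary.Construct.Closure.ReflexiveTransitive using (ε; _◅_; _◅◅_)
import Relation.Binary.Construct.Closure.ReflexiveTransitive as Star
open import Relation.Binary.Construct.Closure.Transitive using (TransClosure; [_]; _∷_)
open import Relation.Binary.PropositionalEquality using (_≡_; _≢_; refl; sym)
open import Relation.Nullary using (¬_; yes; no; _⊎-dec_)
open import Relation.Unary using (_∈_; Pred; Decidable; _⊆_)
open import Level using (0ℓ)

module _ {n : ℕ} (G : DAG n) where
  open DAG G

  private
    V : Set
    V = Fin n

  open DecMembership (_≟_ {n}) using (_∈?_)

  -- Directed paths

  no-return : ∀ {x y} → Arc x y → ¬ Path G y x
  no-return e p = acyclic (close e p)
    where
    close : ∀ {x y z} → Arc x y → Path G y z → TransClosure Arc x z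
    close e ε        = [ e ]
    close e (e′ ◅ p) = e ∷ close e′ p

  path-antisym : ∀ {x y} → Path G x y → Path G y x → x ≡ y
  path-antisym ε       q = refl
  path-antisym (e ◅ p) q = ⊥-elim (no-return e (p ◅◅ q))

  target∈ : ∀ {x y} (p : Path G x y) → y List.∈ vertices G p
  target∈ ε       = here refl
  target∈ (e ◅ p) = there (target∈ p)

  ∈-◅◅ : ∀ {a b c x} (p : Path G a b) (q : Path G b c) →
    x List.∈ vertices G (p ◅◅ q) → x List.∈ vertices G p ⊎ x List.∈ vertices G q
  ∈-◅◅ ε       q x∈         = inj₂ x∈
  ∈-◅◅ (e ◅ p) q (here eq)  = inj₁ (here eq)
  ∈-◅◅ (e ◅ p) q (there x∈) = Sum.map₁ there (∈-◅◅ p q x∈)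

  split : ∀ {a b x} (p : Path G a b) → x List.∈ vertices G p →
    Σ[ q ∈ Path G a x ]
      (∀ {y} → y List.∈ vertices G q → y List.∈ vertices G p) × Path G x b
  split ε       (here refl) = ε , id , ε
  split (e ◅ p) (here refl) = ε , (λ { (here eq) → here eq }) , e ◅ p
  split (e ◅ p) (there x∈) with split p x∈
  ... | q , q⊆p , r =
    e ◅ q , (λ { (here eq) → here eq ; (there y∈) → there (q⊆p y∈) }) , r

  path-from : ∀ {a b x} (p : Path G a b) → x List.∈ vertices G p → Path G x b
  path-from p x∈ = proj₂ (proj₂ (split p x∈))

  -- Either p avoids D, or the part of p from its last vertex in D onwards.
  last-hit : ∀ {D : Pred V 0ℓ} → Decidable D → ∀ {a b} (p : Path G a b) →
    (∀ {x} → x List.∈ vertices G p → ¬ D x) ⊎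
    (∃[ y ] D y × Σ[ q ∈ Path G y b ] (∀ {x} → x List.∈ vertices G q → D x → x ≡ y))
  last-hit D? {a} ε with D? a
  ... | yes d = inj₂ (a , d , ε , λ { (here eq) _ → eq })
  ... | no ¬d = inj₁ λ { (here refl) → ¬d }
  last-hit D? {a} (e ◅ p) with last-hit D? p
  ... | inj₂ hit = inj₂ hit
  ... | inj₁ miss with D? a
  ...   | yes d = inj₂ (a , d , e ◅ p ,
                    λ { (here eq) _ → eq ; (there x∈) dx → ⊥-elim (miss x∈ dx) })
  ...   | no ¬d = inj₁ λ { (here refl) → ¬d ; (there x∈) → miss x∈ }

  J-sym : ∀ {u v} → J G u v ⊆ J G v u
  J-sym (u≢v , P , Q , disj) = u≢v ∘ sym , Q , P , λ x∈Q x∈P → disj x∈P x∈Q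

  -- Leaving P at y for a path R that meets Q at most in y keeps the new path
  -- disjoint from Q.
  switch-disjoint : ∀ {s u v y z} (P : Path G s u) (Q : Path G s v) →
    InternallyDisjoint G P Q →
    y List.∈ vertices G P → (R : Path G y z) →
    (∀ {x} → x List.∈ vertices G R → x List.∈ vertices G Q → x ≡ y) →
    Σ[ P′ ∈ Path G s z ] InternallyDisjoint G P′ Q
  switch-disjoint {s} P Q disj y∈P R only with split P y∈P
  ... | P₁ , P₁⊆P , _ = P₁ ◅◅ R , disj′
    where
    disj′ : InternallyDisjoint G (P₁ ◅◅ R) Q
    disj′ x∈ x∈Q with ∈-◅◅ P₁ R x∈
    ... | inj₁ x∈P₁ = disj (P₁⊆P x∈P₁) x∈Q
    ... | inj₂ x∈R with only x∈R x∈Q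
    ...   | refl = disj y∈P x∈Q

  -- The graph may be any DAG here and z any vertex reachable from s: no tree is
  -- involved.
  reroute : ∀ {s u v z} → z ≢ u → z ≢ v → Path G s z →
    s ∈ J G u v → s ∈ J G z u ⊎ s ∈ J G z v
  reroute {s} {z = z} z≢u z≢v R (_ , P , Q , disj)
    with last-hit (λ x → (x ∈? vertices G P) ⊎-dec (x ∈? vertices G Q)) R
  ... | inj₁ miss = ⊥-elim (miss (source∈ R) (inj₁ (source∈ P)))
    where
    source∈ : ∀ {x y} (p : Path G x y) → x List.∈ vertices G p
    source∈ ε       = here refl
    source∈ (e ◅ p) = here refl
  ... | inj₂ (y , inj₁ y∈P , R′ , only)
    with switch-disjoint P Q disj y∈P R′ (λ x∈ → only x∈ ∘ inj₂)
  ...   | P′ , disj′ = inj₂ (z≢v , P′ , Q , disj′)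
  reroute z≢u z≢v R (_ , P , Q , disj)
      | inj₂ (y , inj₂ y∈Q , R′ , only)
    with switch-disjoint Q P (λ x∈Q x∈P → disj x∈P x∈Q) y∈Q R′ (λ x∈ → only x∈ ∘ inj₁)
  ...   | Q′ , disj′ = inj₁ (z≢u , Q′ , P , disj′)

  -- Visited vertices during a depth-first search

  OutClosed : List V → Pred V 0ℓ
  OutClosed M x = ∀ {w} → Arc x w → w List.∈ M

  -- The vertices visited between two moments with visited sets M and M′.
  New : List V → List V → Pred V 0ℓ
  New M M′ x = x List.∈ M′ × x List.∉ M

  -- The invariant of the search while v is being processed and M is visited:
  -- a visited vertex is still open, and then it reaches v, or else all its
  -- out-neighbours are visited.
  Valid : V → List V → Set
  Valid v M = v List.∈ M × (∀ {x} → x List.∈ M → Path G x v ⊎ OutClosed M x)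

  visited-mono : ∀ {v M A M′ x} → Search G v M A M′ → x List.∈ M → x List.∈ M′
  visited-mono (done _)       x∈ = x∈
  visited-mono (step _ _ S R) x∈ = visited-mono R (visited-mono S (there x∈))

  left-closed : ∀ {v M A M′} → Search G v M A M′ → OutClosed M′ v
  left-closed (done c)       = c
  left-closed (step _ _ _ R) = left-closed R

  new-closed : ∀ {v M A M′ x} → Search G v M A M′ → x List.∈ M′ →
    x List.∈ M ⊎ OutClosed M′ x
  new-closed (done _) x∈ = inj₁ x∈
  new-closed (step _ _ S R) x∈ with new-closed R x∈
  ... | inj₂ c = inj₂ c
  ... | inj₁ x∈M₁ with new-closed S x∈M₁
  ...   | inj₂ c           = inj₂ (visited-mono R ∘ c)
  ...   | inj₁ (here refl) = inj₂ (visited-mono R ∘ left-closed S)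
  ...   | inj₁ (there x∈M) = inj₁ x∈M

  -- The same for a complete visit of w, where w itself counts as new.
  visit-closed : ∀ {w M A M₁ x} → Search G w (w ∷ M) A M₁ → x List.∈ M₁ →
    x List.∈ M ⊎ OutClosed M₁ x
  visit-closed S x∈ with new-closed S x∈
  ... | inj₂ c           = inj₂ c
  ... | inj₁ (here refl) = inj₂ (left-closed S)
  ... | inj₁ (there x∈M) = inj₁ x∈M

  valid-root : ∀ s → Valid s (s ∷ [])
  valid-root s = here refl , λ { (here refl) → inj₁ ε }

  valid-call : ∀ {v w M} → Arc v w → Valid v M → Valid w (w ∷ M)
  valid-call e (_ , inv) = here refl , λ
    { (here refl) → inj₁ ε
    ; (there x∈)  → Sum.map (_◅◅ (e ◅ ε)) (λ c a → there (c a)) (inv x∈)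
    }

  valid-return : ∀ {v w M A M₁} → Search G w (w ∷ M) A M₁ → Valid v M → Valid v M₁
  valid-return {v} {M = M} {M₁ = M₁} S (v∈ , inv) = old v∈ , inv′
    where
    old : ∀ {x} → x List.∈ M → x List.∈ M₁
    old = visited-mono S ∘ there
    inv′ : ∀ {x} → x List.∈ M₁ → Path G x v ⊎ OutClosed M₁ x
    inv′ x∈ with visit-closed S x∈
    ... | inj₂ c  = inj₂ c
    ... | inj₁ x∈M = Sum.map₂ (λ c a → old (c a)) (inv x∈M)

  -- A path from a vertex visited before a to a vertex not visited before a
  -- passes through a or a vertex still open when a is discovered; in either
  -- case its first vertex reaches a.
  escape : ∀ {a M x u} → Valid a (a ∷ M) → x List.∈ M → Path G x u → u List.∉ M →
    Path G x a
  escape val x∈ ε u∉ = ⊥-elim (u∉ x∈)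
  escape val x∈ (e ◅ p) u∉ with proj₂ val (there x∈)
  ... | inj₁ q = q
  ... | inj₂ c with c e
  ...   | here refl = e ◅ ε
  ...   | there y∈  = e ◅ escape val y∈ p u∉

  -- The vertices found from a are convex: a path that left them would have to
  -- enter M, and on its way to u it would escape from M and so reach a again.
  new-convex : ∀ {a M A M₁ y x u} → Valid a (a ∷ M) → Search G a (a ∷ M) A M₁ →
    Path G a y → y ∈ New M M₁ → u List.∉ M → Path G y x → Path G x u →
    x ∈ New M M₁
  new-convex val S r y∈ u∉ ε q = y∈
  new-convex {M = M} val S r (y∈ , y∉) u∉ (_◅_ {j = y′} e p) q =
    new-convex val S (r ◅◅ (e ◅ ε)) (y′∈ , y′∉) u∉ p q
    where
    y′∈ = [ ⊥-elim ∘ y∉ , (λ c → c e) ]′ (visit-closed S y∈)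
    y′∉ : y′ List.∉ M
    y′∉ y′∈M = no-return e (escape val y′∈M (p ◅◅ q) u∉ ◅◅ r)

  -- Tree arcs

  tree-arc : ∀ {v M A M′ x y} → Search G v M A M′ → (x , y) List.∈ A → Arc x y
  tree-arc (step e _ S R) (here refl) = e
  tree-arc (step {A = A} e _ S R) (there i) =
    [ tree-arc S , tree-arc R ]′ (∈-++⁻ A i)

  new-mono : ∀ {w M A M₁ v B M₂} → Search G w (w ∷ M) A M₁ → Search G v M₁ B M₂ →
    New (w ∷ M) M₁ ⊆ New M M₂
  new-mono S R (x∈ , x∉) = visited-mono R x∈ , x∉ ∘ there

  arc-target : ∀ {v M A M′ p q} → Search G v M A M′ → (p , q) List.∈ A → q ∈ New M M′
  arc-target (step e w∉ S R) (here refl) = visited-mono R (visited-mono S (here refl)) , w∉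
  arc-target (step {A = A} e w∉ S R) (there i) with ∈-++⁻ A i
  ... | inj₁ j = new-mono S R (arc-target S j)
  ... | inj₂ j with arc-target R j
  ...   | q∈ , q∉ = q∈ , q∉ ∘ visited-mono S ∘ there

  arc-source : ∀ {v M A M′ p q} → Search G v M A M′ → (p , q) List.∈ A →
    p ≡ v ⊎ p ∈ New M M′
  arc-source (step e w∉ S R) (here refl) = inj₁ refl
  arc-source (step {A = A} e w∉ S R) (there i) with ∈-++⁻ A i
  ... | inj₁ j = inj₂ ([ (λ { refl → visited-mono R (visited-mono S (here refl)) , w∉ })
                       , new-mono S R ]′ (arc-source S j))
  ... | inj₂ j with arc-source R j
  ...   | inj₁ eq = inj₁ eq
  ...   | inj₂ (p∈ , p∉) = inj₂ (p∈ , p∉ ∘ visited-mono S ∘ there)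

  ancestor-mono : ∀ {A B : List (V × V)} → (∀ {e} → e List.∈ A → e List.∈ B) →
    ∀ {x y} → IsAncestorOf A x y → IsAncestorOf B x y
  ancestor-mono A⊆B = Star.map A⊆B

  new-descendant : ∀ {v M A M′ x} → Search G v M A M′ → x List.∈ M′ →
    x List.∈ M ⊎ IsAncestorOf A v x
  new-descendant (done _) x∈ = inj₁ x∈
  new-descendant (step {A = A} _ _ S R) x∈ with new-descendant R x∈
  ... | inj₂ t = inj₂ (ancestor-mono (there ∘ ∈-++⁺ʳ A) t)
  ... | inj₁ x∈M₁ with new-descendant S x∈M₁
  ...   | inj₂ t           = inj₂ (here refl ◅ ancestor-mono (there ∘ ∈-++⁺ˡ) t)
  ...   | inj₁ (here refl) = inj₂ (here refl ◅ ε)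
  ...   | inj₁ (there x∈M) = inj₁ x∈M

  -- N is the vertex set of the subarborescence of A rooted at a (by root,
  -- arc-closed and descendant), and it is convex: it contains every vertex of
  -- every path of G between two of its members.
  record ConvexSubtree (A : List (V × V)) (a : V) (N : Pred V 0ℓ) : Set where
    field
      root       : N a
      arc-closed : ∀ {p q} → N p → (p , q) List.∈ A → N q
      descendant : ∀ {x} → N x → IsAncestorOf A a x
      convex     : ∀ {y x u} → N y → N u → Path G y x → Path G x u → N x

  extend : ∀ {A B a N} → ConvexSubtree A a N →
    (∀ {e} → e List.∈ A → e List.∈ B) →
    (∀ {p q} → N p → (p , q) List.∈ B → (p , q) List.∈ A) →
    ConvexSubtree B a N
  extend C A⊆B back = record
    { root       = root
    ; arc-closed = λ p∈ i → arc-closed p∈ (back p∈ i)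
    ; descendant = ancestor-mono A⊆B ∘ descendant
    ; convex     = convex
    }
    where open ConvexSubtree C

  visit-subtree : ∀ {a M A M₁} → Valid a (a ∷ M) → a List.∉ M →
    Search G a (a ∷ M) A M₁ → ConvexSubtree A a (New M M₁)
  visit-subtree {a} {M} {A} {M₁} val a∉ S = record
    { root       = visited-mono S (here refl) , a∉
    ; arc-closed = λ _ i → let q∈ , q∉ = arc-target S i in q∈ , q∉ ∘ there
    ; descendant = descendant
    ; convex     = λ y∈ u∈ → new-convex val S
                     (Star.map (tree-arc S) (descendant y∈)) y∈ (proj₂ u∈)
    }
    where
    descendant : ∀ {x} → x ∈ New M M₁ → IsAncestorOf A a x
    descendant (x∈ , x∉) with new-descendant S x∈
    ... | inj₂ t           = t
    ... | inj₁ (here refl) = ε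
    ... | inj₁ (there x∈M) = ⊥-elim (x∉ x∈M)

  -- The head of every tree arc spans a convex subtree.  The extra containment
  -- in New M M′ keeps the arcs found elsewhere in the search from starting in
  -- that subtree.
  subtree : ∀ {v M A M′ z a} → Search G v M A M′ → Valid v M → (z , a) List.∈ A →
    Σ[ N ∈ Pred V 0ℓ ] ConvexSubtree A a N × N ⊆ New M M′
  subtree {v} {M} (step {w} {A} {B} {M₁} {M₂} e w∉ S R) val = λ
    { (here refl) → inside (New M M₁) (visit-subtree (valid-call e val) w∉ S) id
    ; (there i)   → [ fromS , fromR ]′ (∈-++⁻ A i)
    }
    where
    T = (v , w) ∷ A ++ B

    inside : ∀ {a} N → ConvexSubtree A a N → N ⊆ New M M₁ →
      Σ[ N ∈ Pred V 0ℓ ] ConvexSubtree T a N × N ⊆ New M M₂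
    inside N C N⊆ = N , extend C (there ∘ ∈-++⁺ˡ) back
                      , λ x → visited-mono R (proj₁ (N⊆ x)) , proj₂ (N⊆ x)
      where
      back : ∀ {p q} → N p → (p , q) List.∈ T → (p , q) List.∈ A
      back Np (here refl) = ⊥-elim (proj₂ (N⊆ Np) (proj₁ val))
      back Np (there i) with ∈-++⁻ A i
      ... | inj₁ j = j
      ... | inj₂ j with arc-source R j
      ...   | inj₁ refl     = ⊥-elim (proj₂ (N⊆ Np) (proj₁ val))
      ...   | inj₂ (_ , p∉) = ⊥-elim (p∉ (proj₁ (N⊆ Np)))

    fromS : ∀ {z a} → (z , a) List.∈ A →
      Σ[ N ∈ Pred V 0ℓ ] ConvexSubtree T a N × N ⊆ New M M₂
    fromS i with subtree S (valid-call e val) i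
    ... | N , C , N⊆ = inside N C λ x → proj₁ (N⊆ x) , proj₂ (N⊆ x) ∘ there

    fromR : ∀ {z a} → (z , a) List.∈ B →
      Σ[ N ∈ Pred V 0ℓ ] ConvexSubtree T a N × N ⊆ New M M₂
    fromR i with subtree R (valid-return S val) i
    ... | N , C , N⊆ = N , extend C (there ∘ ∈-++⁺ʳ A) back
                         , λ x → proj₁ (N⊆ x) , proj₂ (N⊆ x) ∘ visited-mono S ∘ there
      where
      back : ∀ {p q} → N p → (p , q) List.∈ T → (p , q) List.∈ B
      back Np (here refl) = ⊥-elim (proj₂ (N⊆ Np) (visited-mono S (there (proj₁ val))))
      back Np (there i) with ∈-++⁻ A i
      ... | inj₂ j = j
      ... | inj₁ j with arc-source S j
      ...   | inj₁ refl     = ⊥-elim (proj₂ (N⊆ Np) (visited-mono S (here refl)))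
      ...   | inj₂ (p∈ , _) = ⊥-elim (proj₂ (N⊆ Np) p∈)

  -- Junctions and lowest common ancestors

  module _ {s : V} {T : List (V × V)} (dfs : IsDFSArborescence G s T) where

    subarborescence-convex : ∀ {z a y x u} → IsChildOf T a z →
      IsAncestorOf T a y → IsAncestorOf T a u → Path G y x → Path G x u →
      IsAncestorOf T a x
    subarborescence-convex {a = a} c ay au p q
      with subtree (proj₂ dfs) (valid-root s) c
    ... | N , C , _ = descendant (convex (member root ay) (member root au) p q)
      where
      open ConvexSubtree C
      member : ∀ {x y} → N x → IsAncestorOf T x y → N y
      member Nx ε       = Nx
      member Nx (i ◅ t) = member (arc-closed Nx i) t

    tree-path : ∀ {x y} → IsAncestorOf T x y → Path G x y
    tree-path = Star.map (tree-arc (proj₂ dfs))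

    tree-split : ∀ {x y w} (t : IsAncestorOf T x y) → w List.∈ vertices G (tree-path t) →
      IsAncestorOf T x w × IsAncestorOf T w y
    tree-split ε       (here refl) = ε , ε
    tree-split (i ◅ t) (here refl) = ε , i ◅ t
    tree-split (i ◅ t) (there w∈) with tree-split t w∈
    ... | t₁ , t₂ = i ◅ t₁ , t₂

    lca-distinct : ∀ {u v z} → IsLCA T u v z → z ≢ u → u ≢ v
    lca-distinct (zu , _ , lowest) z≢u refl =
      z≢u (path-antisym (tree-path zu) (tree-path (lowest ε ε)))

    -- The two cases are whether Q meets the tree path from z to v; u and v play
    -- asymmetric roles, since Q ends in u.
    junction-below-lca : ∀ {u v z} → IsLCA T u v z → z ≢ s →
      z ≢ u → s ∈ J G z u → s ∈ J G u v
    junction-below-lca {u} {v} {z} lca@(zu , zv , lowest) z≢s z≢u (_ , P , Q , disj)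
      with any? (λ x → x ∈? vertices G (tree-path zv)) (vertices G Q)
    ... | no miss = lca-distinct lca z≢u , Q , P ◅◅ tree-path zv , disj′
      where
      disj′ : InternallyDisjoint G Q (P ◅◅ tree-path zv)
      disj′ x∈Q x∈ with ∈-◅◅ P (tree-path zv) x∈
      ... | inj₁ x∈P  = disj x∈P x∈Q
      ... | inj₂ x∈zv = ⊥-elim (miss (List.lose x∈Q x∈zv))
    ... | yes hit with List.find hit
    ...   | x , x∈Q , x∈zv with split Q x∈Q | tree-split zv x∈zv
    ...     | Q₁ , Q₁⊆Q , Q₂ | zx , xv =
      lca-distinct lca z≢u , P ◅◅ tree-path zu , Q₁ ◅◅ tree-path xv , disj′
      where
      z∉Q : z List.∉ vertices G Q
      z∉Q z∈Q = z≢s (disj (target∈ P) z∈Q)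

      -- x lies strictly below z, since Q avoids z.
      ¬x→z : ¬ Path G x z
      ¬x→z p with path-antisym (tree-path zx) p
      ... | refl = z∉Q x∈Q

      -- Q meets no vertex y of the tree path from z to u before reaching x.
      -- Otherwise, by convexity, the child a of z on the way to y would be an
      -- ancestor of x, hence a common ancestor of u and v strictly below z.
      no-detour : ∀ {y} → y List.∈ vertices G Q₁ → IsAncestorOf T z y →
        IsAncestorOf T y u → ⊥
      no-detour y∈Q₁ ε       yu = z∉Q (Q₁⊆Q y∈Q₁)
      no-detour y∈Q₁ (i ◅ t) yu = no-return (tree-arc (proj₂ dfs) i)
        (tree-path (lowest (t ◅◅ yu) (ax ◅◅ xv)))
        where ax = subarborescence-convex i t (t ◅◅ yu) (path-from Q₁ y∈Q₁) Q₂

      disj′ : InternallyDisjoint G (P ◅◅ tree-path zu) (Q₁ ◅◅ tree-path xv)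
      disj′ y∈ y∈′ with ∈-◅◅ P (tree-path zu) y∈ | ∈-◅◅ Q₁ (tree-path xv) y∈′
      ... | inj₁ y∈P  | inj₁ y∈Q₁ = disj y∈P (Q₁⊆Q y∈Q₁)
      ... | inj₁ y∈P  | inj₂ y∈xv =
        ⊥-elim (¬x→z (tree-path (proj₁ (tree-split xv y∈xv)) ◅◅ path-from P y∈P))
      ... | inj₂ y∈zu | inj₁ y∈Q₁ with tree-split zu y∈zu
      ...   | zy , yu = ⊥-elim (no-detour y∈Q₁ zy yu)
      disj′ y∈ y∈′ | inj₂ y∈zu | inj₂ y∈xv with tree-split zu y∈zu | tree-split xv y∈xv
      ...   | _ , yu | xy , yv = ⊥-elim (¬x→z (tree-path (xy ◅◅ lowest yu yv)))

  lca-sym : ∀ {T : List (V × V)} {u v z} → IsLCA T u v z → IsLCA T v u z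
  lca-sym (zu , zv , lowest) = zv , zu , λ wv wu → lowest wu wv

lemma2 : ∀ {n : ℕ} (G : DAG n) (s : Fin n) (T : List (Fin n × Fin n)) →
    IsDFSArborescence G s T →
    ∀ (s₁ u v z : Fin n) →
    IsChildOf T s₁ s →
    u ∈ Subarborescence T s₁ →
    v ∈ Subarborescence T s₁ →
    IsLCA T u v z →
    z ≢ u →
    z ≢ v →
    (s ∈ J G u v) ⇔ ((s ∈ J G z u) ⊎ (s ∈ J G z v))
lemma2 G s T dfs s₁ u v z c s₁u s₁v lca z≢u z≢v = mk⇔
  (reroute G z≢u z≢v (tree-path G dfs (c ◅ s₁z)))
  [ junction-below-lca G dfs lca z≢s z≢u
  , J-sym G ∘ junction-below-lca G dfs (lca-sym G lca) z≢s z≢v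
  ]′
  where
  s₁z : IsAncestorOf T s₁ z
  s₁z = proj₂ (proj₂ lca) s₁u s₁v
  -- The lowest common ancestor lies below s₁, hence strictly below s.
  z≢s : z ≢ s
  z≢s refl = no-return G (tree-arc G (proj₂ dfs) c) (tree-path G dfs s₁z)
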